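{- Let $n\ge4$, $\varphi\in S_n$, $I=\{1,\dots,n\}$ and $\mathcal M=\mathfrak{M}_{(n,\varphi)}$. The following conditions are equivalent: (i) there is a special decomposition of $\mathcal M$; (ii) $n=4$ and there is $X\subset I$ such that $|X|=2$ and $\varphi(X)=X$.
   Context: Let $n\ge 3$, $I=\{1,\dots,n\}$, $\varphi\in S_n$ a permutation of $I$, and let $A=\{a_1,\dots,a_n\}$, $B=\{b_1,\dots,b_n\}$ be disjoint $n$-element sets. For $i\in I$ put $A_i=(A\setminus\{a_i\})\cup\{b_i\}$ and $B_i=(B\setminus\{b_i\})\cup\{a_{\varphi(i)}\}$, $\mathcal L_A=\{A_i:i\in I\}$, $\mathcal L_B=\{B_i:i\in I\}$. The Möbius $n$-pair $\mathfrak{M}_{(n,\varphi)}$ is the point-block structure with point set $A\cup B$ and block set $\mathcal L_A\cup\mathcal L_B$. Its standard simplices are $S_A(\mathcal M)=\langle A,\mathcal L_A\rangle$ and $S_B(\mathcal M)=\langle B,\mathcal L_B\rangle$. A decomposition of $\mathcal M$ into two complementary, mutually inscribed simplices $S_1=\langle P_1,\mathcal K_1\rangle$, $S_2=\langle P_2,\mathcal K_2\rangle$ consists of a partition $P_1\sqcup P_2$ of the points into two $n$-sets and a partition $\mathcal K_1\sqcup\mathcal K_2$ of the blocks into two $n$-sets such that: for $t=1,2$ every point of $P_t$ lies on all but exactly one of the blocks in $\mathcal K_t$, and every block in $\mathcal K_t$ contains all but exactly one of the points of $P_t$; and for $s\ne t$ every point of $P_t$ lies on exactly one block of $\mathcal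 K_s$, and every block of $\mathcal K_t$ contains exactly one point of $P_s$. For $n\ge 4$, it is called a special decomposition if $S_t\neq S_A(\mathcal M)$ and $S_t\ne S_B(\mathcal M)$ for $t=1,2$. -}

module Defs where

open import Data.Fin using (Fin; _↑ˡ_; _↑ʳ_; splitAt)
open import Data.Fin.Permutation using (Permutation′; _⟨$⟩ʳ_)
open import Data.Fin.Subset using (Subset; _∈_; _∉_; _∪_; _∩_; _-_; ⁅_⁆; ∣_∣; ⊤; ⊥)
open import Data.Nat using (ℕ; _+_)
open import Data.Product using (_×_; ∃; ∃!)
open import Data.Sum using ([_,_]′)
open import Data.Vec using (_++_)
open import Function.Bundles using (_⇔_)
open import Relation.Binary.PropositionalEquality using (_≡_; _≢_)

-- A point-block structure on v points and with b blocks, each block being a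
-- set of points.  Sets of blocks are given as sets of block indices.
record Structure (v b : ℕ) : Set where
  field
    block : Fin b → Subset v

record Part (v b : ℕ) : Set where
  constructor ⟨_,_⟩
  field
    points : Subset v
    blocks : Subset b

record Bipartition {m : ℕ} (n : ℕ) (X Y : Subset m) : Set where
  field
    disjoint : X ∩ Y ≡ ⊥
    covering : X ∪ Y ≡ ⊤
    size₁    : ∣ X ∣ ≡ n
    size₂    : ∣ Y ∣ ≡ n

module _ {v b : ℕ} (𝓜 : Structure v b) where
  open Structure 𝓜
  open Part

  -- "All but exactly one" is expressed as "exactly one is not".
  record IsSimplex (S : Part v b) : Set where
    field
      point-misses-one : ∀ p → p ∈ points S → ∃! _≡_ λ k → k ∈ blocks S × p ∉ block k
      block-misses-one : ∀ k → k ∈ blocks S → ∃! _≡_ λ p → p ∈ points S × p ∉ block k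

  record Inscribed (S T : Part v b) : Set where
    field
      point-on-one   : ∀ p → p ∈ points S → ∃! _≡_ λ k → k ∈ blocks T × p ∈ block k
      block-hits-one : ∀ k → k ∈ blocks S → ∃! _≡_ λ p → p ∈ points T × p ∈ block k

  record Decomposition (n : ℕ) : Set where
    field
      S₁ S₂            : Part v b
      points-partition : Bipartition n (points S₁) (points S₂)
      blocks-partition : Bipartition n (blocks S₁) (blocks S₂)
      simplex₁         : IsSimplex S₁
      simplex₂         : IsSimplex S₂
      inscribed₁₂      : Inscribed S₁ S₂
      inscribed₂₁      : Inscribed S₂ S₁

-- The points aᵢ are the first n elements of Fin (n + n), the points bᵢ the
-- last n.  The block indices are arranged in the same way: first the Aᵢ, then
-- the Bᵢ.  For n ≥ 3 these 2n blocks are pairwise distinct as sets of points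
-- (Aᵢ is the only Aⱼ without aᵢ, and dually for Bᵢ; Aᵢ contains n - 1 ≥ 2 of
-- the points a₁, …, aₙ, while every Bⱼ contains just one), so sets of block
-- indices and sets of blocks are then the same thing.
module _ (n : ℕ) where

  a b : Fin n → Fin (n + n)
  a i = i ↑ˡ n
  b i = n ↑ʳ i

  firstHalf secondHalf : Subset (n + n)
  firstHalf  = ⊤ {n} ++ ⊥ {n}
  secondHalf = ⊥ {n} ++ ⊤ {n}

  module _ (φ : Permutation′ n) where

    blockA blockB : Fin n → Subset (n + n)
    blockA i = (firstHalf - a i) ∪ ⁅ b i ⁆
    blockB i = (secondHalf - b i) ∪ ⁅ a (φ ⟨$⟩ʳ i) ⁆

    Möbius : Structure (n + n) (n + n)
    Möbius = record { block = λ k → [ blockA , blockB ]′ (splitAt n k) }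

  simplexA simplexB : Part (n + n) (n + n)
  simplexA = ⟨ firstHalf , firstHalf ⟩
  simplexB = ⟨ secondHalf , secondHalf ⟩

record IsSpecial (n : ℕ) (φ : Permutation′ n) (D : Decomposition (Möbius n φ) n) : Set where
  open Decomposition D
  field
    S₁≢A : S₁ ≢ simplexA n
    S₁≢B : S₁ ≢ simplexB n
    S₂≢A : S₂ ≢ simplexA n
    S₂≢B : S₂ ≢ simplexB n

SpecialDecomposition : (n : ℕ) → Permutation′ n → Set
SpecialDecomposition n φ = ∃ λ (D : Decomposition (Möbius n φ) n) → IsSpecial n φ D

-- φ(X) = X, by extensionality.
ImageEqual : {n : ℕ} → Permutation′ n → Subset n → Set
ImageEqual φ X = ∀ y → (∃ λ x → x ∈ X × φ ⟨$⟩ʳ x ≡ y) ⇔ y ∈ X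

{-# OPTIONS --safe #-}

-- Let the part S₁ consist of the aᵢ with i ∈ X, the bᵢ with i ∈ Y, the Aᵢ
-- with i ∈ U and the Bᵢ with i ∈ V, so that S₂ is given by the complements.
-- For i ∉ U the block Aᵢ has exactly one point in S₁, that is
-- ∣X∣ + [i ∈ Y] = 1 + [i ∈ X], hence ∣X∣ ≤ 2; likewise ∣∁X∣ = ∣Y∣ ≤ 2 if
-- some i is in U.  If U = ∅ these equations force X = ∅, so S₁ = S_B; if
-- U = I then S₂ = S_B.  Otherwise n = ∣X∣ + ∣Y∣ ≤ 4, so ∣X∣ = ∣Y∣ = 2; then
-- the equations say Y = ∁X, and those of the blocks Bᵢ say
-- i ∈ Y ⇔ φ(i) ∉ X.  Conversely a φ-invariant 2-set X gives a special
-- decomposition with Y = U = ∁X and V = X.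
module Submission where

open import Defs
open import Data.Bool using (Bool; true; false; not)
open import Data.Bool.Properties using (not-involutive; not-injective)
open import Data.Empty using (⊥-elim)
open import Data.Fin using (Fin; zero; fromℕ<; suc; _↑ˡ_; _↑ʳ_; splitAt)
open import Data.Fin.Permutation using (Permutation′; _⟨$⟩ʳ_; _⟨$⟩ˡ_; inverseˡ; inverseʳ)
open import Data.Fin.Properties
  using (_≟_; ↑ˡ-injective; ↑ʳ-injective; splitAt-↑ˡ; splitAt-↑ʳ; splitAt⁻¹-↑ˡ; splitAt⁻¹-↑ʳ)
open import Data.Fin.Subset
  using (Subset; inside; outside; _∈_; _∉_; _∪_; _∩_; _─_; _-_; ⁅_⁆; ∣_∣; ⊤; ⊥; ∁)
open import Data.Fin.Subset.Properties
open import Data.Nat using (ℕ; zero; suc; _+_; _≤_; _≥_; z≤n; s≤s)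
open import Data.Nat.Properties
  using (+-comm; +-assoc; +-identityʳ; suc-injective; +-cancelˡ-≡; +-cancelʳ-≡; +-cancelʳ-≤;
         +-monoʳ-≤; m≤m+n; ≤-antisym; ≤-trans; ≤-reflexive; m+[n∸m]≡n)
open import Data.Product using (_×_; _,_; ∃; ∃!; proj₁; proj₂)
open import Data.Product.Function.NonDependent.Propositional using (_×-⇔_)
open import Data.Sum using (inj₁; inj₂; [_,_]′)
open import Data.Vec as Vec using ([]; _∷_; _++_; lookup; here; there)
open import Data.Vec.Properties
  using ([]=⇒lookup; lookup⇒[]=; lookup-map; lookup-++ˡ; lookup-++ʳ; map-++; ++-injectiveˡ)
open import Function using (_∘_; case_of_)
open import Function.Bundles using (_⇔_; mk⇔; Equivalence)
open import Function.Properties.Equivalence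
  using () renaming (refl to ⇔-refl; sym to ⇔-sym; trans to ⇔-trans)
open import Function.Related.TypeIsomorphisms using (¬-cong-⇔)
open import Relation.Binary.PropositionalEquality
  using (_≡_; _≢_; refl; sym; trans; cong; cong₂; subst; module ≡-Reasoning)
open import Relation.Nullary using (¬_; yes; no; contradiction)
open import Relation.Nullary.Decidable using (decidable-stable)

open Equivalence using (to; from)

private variable
  m n : ℕ

-- Unique existence and the two halves of an index range

∃!-cong : {A : Set} {P Q : A → Set} → (∀ x → P x ⇔ Q x) → ∃! _≡_ P → ∃! _≡_ Q
∃!-cong P⇔Q (x , Px , unique) = x , to (P⇔Q x) Px , λ {y} Qy → unique (from (P⇔Q y) Qy)

-- `a n i` and `b n i` unfold to `i ↑ˡ n` and `n ↑ʳ i`, so this splits any claim about points or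
-- blocks into the cases of the two kinds.
halves : (P : Fin (m + n) → Set) → (∀ i → P (i ↑ˡ n)) → (∀ i → P (m ↑ʳ i)) → ∀ k → P k
halves {m} P l r k with splitAt m k in eq
... | inj₁ i = subst P (splitAt⁻¹-↑ˡ eq) (l i)
... | inj₂ i = subst P (splitAt⁻¹-↑ʳ {m} eq) (r i)

module _ {P : Fin (m + n) → Set} where

  ∃!-↑ˡ : ∃! _≡_ (λ i → P (i ↑ˡ n)) → (∀ i → ¬ P (m ↑ʳ i)) → ∃! _≡_ P
  ∃!-↑ˡ (x , Px , unique) ¬r = x ↑ˡ n , Px , λ {y} → halves (λ y → P y → x ↑ˡ n ≡ y)
    (λ i Pi → cong (_↑ˡ n) (unique Pi)) (λ i Pi → contradiction Pi (¬r i)) y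

  ∃!-↑ʳ : ∃! _≡_ (λ i → P (m ↑ʳ i)) → (∀ i → ¬ P (i ↑ˡ n)) → ∃! _≡_ P
  ∃!-↑ʳ (x , Px , unique) ¬l = m ↑ʳ x , Px , λ {y} → halves (λ y → P y → m ↑ʳ x ≡ y)
    (λ i Pi → contradiction Pi (¬l i)) (λ i Pi → cong (m ↑ʳ_) (unique Pi)) y

↑ˡ≢↑ʳ : ∀ (i : Fin m) (j : Fin n) → i ↑ˡ n ≢ m ↑ʳ j
↑ˡ≢↑ʳ {m} {n} i j eq with () ← trans (sym (splitAt-↑ˡ m i n)) (trans (cong (splitAt m) eq) (splitAt-↑ʳ m n j))

-- Subsets of a finite set

-- Iverson bracket: `⟦ lookup p x ⟧` lets the membership of `x` in `p` enter equations between
-- cardinalities.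
⟦_⟧ : Bool → ℕ
⟦ true  ⟧ = 1
⟦ false ⟧ = 0

∈-++ˡ : (X : Subset m) (Y : Subset n) {i : Fin m} → i ∈ X ⇔ (i ↑ˡ n) ∈ X ++ Y
∈-++ˡ X Y {i} = mk⇔
  (λ i∈X → lookup⇒[]= _ _ (trans (lookup-++ˡ X Y i) ([]=⇒lookup i∈X)))
  (λ i∈XY → lookup⇒[]= _ _ (trans (sym (lookup-++ˡ X Y i)) ([]=⇒lookup i∈XY)))

∈-++ʳ : (X : Subset m) (Y : Subset n) {i : Fin n} → i ∈ Y ⇔ (m ↑ʳ i) ∈ X ++ Y
∈-++ʳ X Y {i} = mk⇔
  (λ i∈Y → lookup⇒[]= _ _ (trans (lookup-++ʳ X Y i) ([]=⇒lookup i∈Y)))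
  (λ i∈XY → lookup⇒[]= _ _ (trans (sym (lookup-++ʳ X Y i)) ([]=⇒lookup i∈XY)))

∈∁⇔∉ : {X : Subset n} {i : Fin n} → i ∈ ∁ X ⇔ i ∉ X
∈∁⇔∉ = mk⇔ x∈∁p⇒x∉p x∉p⇒x∈∁p

x∈p─q⇒x∉q : (p q : Subset n) {x : Fin n} → x ∈ p ─ q → x ∉ q
x∈p─q⇒x∉q (_ ∷ p) (outside ∷ q) (there x∈) (there x∈q) = x∈p─q⇒x∉q p q x∈ x∈q
x∈p─q⇒x∉q (_ ∷ p) (inside  ∷ q) (there x∈) (there x∈q) = x∈p─q⇒x∉q p q x∈ x∈q

∈p-x⇔ : (p : Subset n) {x y : Fin n} → x ∈ p - y ⇔ (x ∈ p × x ≢ y)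
∈p-x⇔ p {x} {y} = mk⇔
  (λ x∈ → p─q⊆p p ⁅ y ⁆ x∈ , x∉⁅y⁆⇒x≢y (x∈p─q⇒x∉q p ⁅ y ⁆ x∈))
  (λ (x∈p , x≢y) → x∈p∧x≢y⇒x∈p-y x∈p x≢y)

∈p∩⁅x⁆⇔ : (p : Subset n) {x y : Fin n} → x ∈ p ∩ ⁅ y ⁆ ⇔ (x ∈ p × x ≡ y)
∈p∩⁅x⁆⇔ p = ⇔-trans ∩⇔× (⇔-refl ×-⇔ x∈⁅y⁆⇔x≡y)

∣++∣ : (X : Subset m) (Y : Subset n) → ∣ X ++ Y ∣ ≡ ∣ X ∣ + ∣ Y ∣
∣++∣ []            Y = refl
∣++∣ (inside  ∷ X) Y = cong suc (∣++∣ X Y)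
∣++∣ (outside ∷ X) Y = ∣++∣ X Y

∣p-x∣ : (p : Subset n) (x : Fin n) → ∣ p - x ∣ + ⟦ lookup p x ⟧ ≡ ∣ p ∣
∣p-x∣ (inside  ∷ p) zero    = trans (cong (λ q → ∣ q ∣ + 1) (p─⊥≡p p)) (+-comm ∣ p ∣ 1)
∣p-x∣ (outside ∷ p) zero    = trans (cong (λ q → ∣ q ∣ + 0) (p─⊥≡p p)) (+-identityʳ ∣ p ∣)
∣p-x∣ (inside  ∷ p) (suc x) = cong suc (∣p-x∣ p x)
∣p-x∣ (outside ∷ p) (suc x) = ∣p-x∣ p x

∣p∩⁅x⁆∣ : (p : Subset n) (x : Fin n) → ∣ p ∩ ⁅ x ⁆ ∣ ≡ ⟦ lookup p x ⟧
∣p∩⁅x⁆∣ {suc n} (inside  ∷ p) zero = cong suc (trans (cong ∣_∣ (∩-zeroʳ p)) (∣⊥∣≡0 n))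
∣p∩⁅x⁆∣ {suc n} (outside ∷ p) zero = trans (cong ∣_∣ (∩-zeroʳ p)) (∣⊥∣≡0 n)
∣p∩⁅x⁆∣ (inside  ∷ p) (suc x) = ∣p∩⁅x⁆∣ p x
∣p∩⁅x⁆∣ (outside ∷ p) (suc x) = ∣p∩⁅x⁆∣ p x

∣p∣≡0⇒p≡⊥ : (p : Subset n) → ∣ p ∣ ≡ 0 → p ≡ ⊥
∣p∣≡0⇒p≡⊥ []            _  = refl
∣p∣≡0⇒p≡⊥ (outside ∷ p) eq = cong (outside ∷_) (∣p∣≡0⇒p≡⊥ p eq)

∣p∣≡1⇒∃! : (p : Subset n) → ∣ p ∣ ≡ 1 → ∃! _≡_ (_∈ p)
∣p∣≡1⇒∃! (inside ∷ p) eq = zero , here , λ where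
  here        → refl
  (there x∈p) → contradiction (subst (_ ∈_) (∣p∣≡0⇒p≡⊥ p (suc-injective eq)) x∈p) ∉⊥
∣p∣≡1⇒∃! (outside ∷ p) eq with x , x∈p , unique ← ∣p∣≡1⇒∃! p eq =
  suc x , there x∈p , λ { (there y∈p) → cong suc (unique y∈p) }

∃!⇒∣p∣≡1 : (p : Subset n) → ∃! _≡_ (_∈ p) → ∣ p ∣ ≡ 1
∃!⇒∣p∣≡1 p (x , x∈p , unique) = trans (cong ∣_∣ p≡⁅x⁆) (∣⁅x⁆∣≡1 x)
  where
  p≡⁅x⁆ : p ≡ ⁅ x ⁆
  p≡⁅x⁆ = ⊆-antisym
    (λ y∈p → from x∈⁅y⁆⇔x≡y (sym (unique y∈p)))
    (λ y∈⁅x⁆ → subst (_∈ p) (sym (to x∈⁅y⁆⇔x≡y y∈⁅x⁆)) x∈p)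

-- Source of every unique witness in the construction: each simplex or inscription condition there
-- comes down to the other element of a 2-set.
∃!-other : (Z : Subset n) → ∣ Z ∣ ≡ 2 → ∀ {z} → z ∈ Z → ∃! _≡_ λ j → j ∈ Z × j ≢ z
∃!-other Z ∣Z∣≡2 {z} z∈Z = ∃!-cong (λ _ → ∈p-x⇔ Z) (∣p∣≡1⇒∃! (Z - z) (+-cancelʳ-≡ 1 _ 1 (begin
  ∣ Z - z ∣ + 1              ≡⟨ cong (λ s → ∣ Z - z ∣ + ⟦ s ⟧) ([]=⇒lookup z∈Z) ⟨
  ∣ Z - z ∣ + ⟦ lookup Z z ⟧ ≡⟨ ∣p-x∣ Z z ⟩
  ∣ Z ∣                      ≡⟨ ∣Z∣≡2 ⟩
  2                          ∎)))
  where open ≡-Reasoning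

∣p∣+∣∁p∣≡n : (p : Subset n) → ∣ p ∣ + ∣ ∁ p ∣ ≡ n
∣p∣+∣∁p∣≡n p = trans (cong (∣ p ∣ +_) (∣∁p∣≡n∸∣p∣ p)) (m+[n∸m]≡n (∣p∣≤n p))

∁-involutive : (p : Subset n) → ∁ (∁ p) ≡ p
∁-involutive []      = refl
∁-involutive (s ∷ p) = cong₂ _∷_ (not-involutive s) (∁-involutive p)

complement-unique : (p q : Subset n) → p ∩ q ≡ ⊥ → p ∪ q ≡ ⊤ → q ≡ ∁ p
complement-unique p q p∩q≡⊥ p∪q≡⊤ = ⊆-antisym
  (λ x∈q → x∉p⇒x∈∁p (λ x∈p → ∉⊥ (subst (_ ∈_) p∩q≡⊥ (x∈p∩q⁺ (x∈p , x∈q)))))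
  (λ x∈∁p → case x∈p∪q⁻ p q (subst (_ ∈_) (sym p∪q≡⊤) ∈⊤) of λ where
    (inj₁ x∈p) → contradiction x∈p (x∈∁p⇒x∉p x∈∁p)
    (inj₂ x∈q) → x∈q)

complement-++ : (X : Subset m) (Y : Subset n) (Z : Subset (m + n)) →
  (X ++ Y) ∩ Z ≡ ⊥ → (X ++ Y) ∪ Z ≡ ⊤ → Z ≡ ∁ X ++ ∁ Y
complement-++ X Y Z ∩≡⊥ ∪≡⊤ = trans (complement-unique (X ++ Y) Z ∩≡⊥ ∪≡⊤) (map-++ not X Y)

-- Arithmetic of the hit equations

m+⟦⟧≡1+⟦⟧⇒m≤2 : ∀ {m} s t → m + ⟦ s ⟧ ≡ 1 + ⟦ t ⟧ → m ≤ 2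
m+⟦⟧≡1+⟦⟧⇒m≤2 {m} s t eq = ≤-trans (m≤m+n m ⟦ s ⟧) (≤-trans (≤-reflexive eq) (s≤s (⟦⟧≤1 t)))
  where
  ⟦⟧≤1 : ∀ t → ⟦ t ⟧ ≤ 1
  ⟦⟧≤1 true  = s≤s z≤n
  ⟦⟧≤1 false = z≤n

⟦⟧-injective : ∀ s t → ⟦ s ⟧ ≡ ⟦ t ⟧ → s ≡ t
⟦⟧-injective true  true  _ = refl
⟦⟧-injective false false _ = refl

2+⟦⟧≡1+⟦⟧ : ∀ s t → 2 + ⟦ s ⟧ ≡ 1 + ⟦ t ⟧ → s ≡ not t × t ≡ true
2+⟦⟧≡1+⟦⟧ false true _ = refl , refl

4≤m+n⇒m≡2 : ∀ {m n} → 4 ≤ m + n → m ≤ 2 → n ≤ 2 → m ≡ 2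
4≤m+n⇒m≡2 {m} 4≤m+n m≤2 n≤2 =
  ≤-antisym m≤2 (+-cancelʳ-≤ 2 2 m (≤-trans 4≤m+n (+-monoʳ-≤ m n≤2)))

lookup-ext : (p q : Subset n) → (∀ i → lookup p i ≡ lookup q i) → p ≡ q
lookup-ext []      []      _  = refl
lookup-ext (_ ∷ p) (_ ∷ q) eq = cong₂ _∷_ (eq zero) (lookup-ext p q (eq ∘ suc))

-- Blocks of S₁ yield equations in the complements; negating both sides turns them into the
-- equations that blocks of S₂ yield for the sets themselves.
lookup-∁⁻ : (p : Subset m) (q : Subset n) {i : Fin m} {j : Fin n} →
  lookup (∁ p) i ≡ not (lookup (∁ q) j) → lookup p i ≡ not (lookup q j)
lookup-∁⁻ p q {i} {j} eq = not-injective (begin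
  not (lookup p i)       ≡⟨ lookup-map i not p ⟨
  lookup (∁ p) i         ≡⟨ eq ⟩
  not (lookup (∁ q) j)   ≡⟨ cong not (lookup-map j not q) ⟩
  not (not (lookup q j)) ∎)
  where open ≡-Reasoning

module _ (X Y : Subset n) (n≥4 : n ≥ 4) (∣X∣+∣Y∣≡n : ∣ X ∣ + ∣ Y ∣ ≡ n)
  (hits : ∀ i → ∣ X ∣ + ⟦ lookup Y i ⟧ ≡ 1 + ⟦ lookup X i ⟧) where

  -- The equations bound `∣ X ∣` by 2. If it is 1, they read `⟦ lookup Y i ⟧ ≡ ⟦ lookup X i ⟧`, so
  -- `Y` equals `X`; if it is 2, they put every index into `X`. Both give `n ≡ 2`, against `n ≥ 4`.
  all-hit⇒≡⊥ : X ≡ ⊥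
  all-hit⇒≡⊥ = ∣p∣≡0⇒p≡⊥ X (aux ∣ X ∣ refl)
    where
    n≢2 : n ≢ 2
    n≢2 n≡2 with s≤s (s≤s ()) ← subst (4 ≤_) n≡2 n≥4

    -- The bound by 2 is read off the equation at some index, so one must exist.
    i₀ : Fin n
    i₀ = fromℕ< (≤-trans (s≤s z≤n) n≥4)

    aux : ∀ x → ∣ X ∣ ≡ x → x ≡ 0
    aux 0 _ = refl
    aux 1 ∣X∣≡1 = ⊥-elim (n≢2 (trans (sym ∣X∣+∣Y∣≡n) (cong₂ _+_ ∣X∣≡1 (trans (cong ∣_∣ (sym X≡Y)) ∣X∣≡1))))
      where
      X≡Y : X ≡ Y
      X≡Y = lookup-ext X Y λ i → ⟦⟧-injective _ _ (suc-injective
        (trans (sym (hits i)) (cong (_+ ⟦ lookup Y i ⟧) ∣X∣≡1)))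
    aux 2 ∣X∣≡2 = ⊥-elim (n≢2 (trans (sym (∣⊤∣≡n n)) (trans (cong ∣_∣ (sym X≡⊤)) ∣X∣≡2)))
      where
      X≡⊤ : X ≡ ⊤
      X≡⊤ = ⊆-antisym ⊆⊤ λ {i} _ → lookup⇒[]= i X (proj₂ (2+⟦⟧≡1+⟦⟧ (lookup Y i) _
        (trans (cong (_+ ⟦ lookup Y i ⟧) (sym ∣X∣≡2)) (hits i))))
    aux (suc (suc (suc x))) ∣X∣≡3+x
      with s≤s (s≤s ()) ← subst (_≤ 2) ∣X∣≡3+x (m+⟦⟧≡1+⟦⟧⇒m≤2 (lookup Y i₀) (lookup X i₀) (hits i₀))

∣⊥++q∣≡n⇒q≡⊤ : (q : Subset n) → ∣ ⊥ {n} ++ q ∣ ≡ n → q ≡ ⊤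
∣⊥++q∣≡n⇒q≡⊤ {n} q ∣⊥++q∣≡n = ∣p∣≡n⇒p≡⊤
  (trans (cong (_+ ∣ q ∣) (sym (∣⊥∣≡0 n))) (trans (sym (∣++∣ (⊥ {n}) q)) ∣⊥++q∣≡n))

-- Incidence in the Möbius pair

module _ (n : ℕ) (φ : Permutation′ n) where
  open Structure (Möbius n φ)
  open Part

  φ-injective : ∀ {i j} → φ ⟨$⟩ʳ i ≡ φ ⟨$⟩ʳ j → i ≡ j
  φ-injective eq = trans (sym (inverseˡ φ)) (trans (cong (φ ⟨$⟩ˡ_) eq) (inverseˡ φ))

  block-a : ∀ i → block (a n i) ≡ blockA n φ i
  block-a i = cong [ blockA n φ , blockB n φ ]′ (splitAt-↑ˡ n i n)

  block-b : ∀ i → block (b n i) ≡ blockB n φ i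
  block-b i = cong [ blockA n φ , blockB n φ ]′ (splitAt-↑ʳ n n i)

  -- From here on incidence is used only through `a∈A`, `b∈A`, `a∈B` and `b∈B`.
  a∈A : ∀ {j i} → a n j ∈ block (a n i) ⇔ j ≢ i
  a∈A {j} {i} rewrite block-a i = mk⇔
    (λ j∈ → case x∈p∪q⁻ (firstHalf n - a n i) _ j∈ of λ where
      (inj₁ j∈) j≡i → proj₂ (to (∈p-x⇔ (firstHalf n)) j∈) (cong (a n) j≡i)
      (inj₂ j∈) _ → ↑ˡ≢↑ʳ j i (x∈⁅y⁆⇒x≡y _ j∈))
    (λ j≢i → x∈p∪q⁺ (inj₁ (from (∈p-x⇔ (firstHalf n)) (to (∈-++ˡ ⊤ ⊥) ∈⊤ , j≢i ∘ ↑ˡ-injective n j i))))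

  b∈A : ∀ {j i} → b n j ∈ block (a n i) ⇔ j ≡ i
  b∈A {j} {i} rewrite block-a i = mk⇔
    (λ j∈ → case x∈p∪q⁻ (firstHalf n - a n i) _ j∈ of λ where
      (inj₁ j∈) → contradiction (from (∈-++ʳ (⊤ {n}) ⊥) (proj₁ (to (∈p-x⇔ (firstHalf n)) j∈))) ∉⊥
      (inj₂ j∈) → ↑ʳ-injective n j i (x∈⁅y⁆⇒x≡y _ j∈))
    (λ { refl → x∈p∪q⁺ (inj₂ (x∈⁅x⁆ _)) })

  a∈B : ∀ {j i} → a n j ∈ block (b n i) ⇔ j ≡ φ ⟨$⟩ʳ i
  a∈B {j} {i} rewrite block-b i = mk⇔
    (λ j∈ → case x∈p∪q⁻ (secondHalf n - b n i) _ j∈ of λ where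
      (inj₁ j∈) → contradiction (from (∈-++ˡ ⊥ (⊤ {n})) (proj₁ (to (∈p-x⇔ (secondHalf n)) j∈))) ∉⊥
      (inj₂ j∈) → ↑ˡ-injective n j _ (x∈⁅y⁆⇒x≡y _ j∈))
    (λ { refl → x∈p∪q⁺ (inj₂ (x∈⁅x⁆ _)) })

  b∈B : ∀ {j i} → b n j ∈ block (b n i) ⇔ j ≢ i
  b∈B {j} {i} rewrite block-b i = mk⇔
    (λ j∈ → case x∈p∪q⁻ (secondHalf n - b n i) _ j∈ of λ where
      (inj₁ j∈) j≡i → proj₂ (to (∈p-x⇔ (secondHalf n)) j∈) (cong (b n) j≡i)
      (inj₂ j∈) _ → ↑ˡ≢↑ʳ (φ ⟨$⟩ʳ i) j (sym (x∈⁅y⁆⇒x≡y _ j∈)))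
    (λ j≢i → x∈p∪q⁺ (inj₁ (from (∈p-x⇔ (secondHalf n)) (to (∈-++ʳ (⊥ {n}) ⊤) ∈⊤ , j≢i ∘ ↑ʳ-injective n j i))))

  -- From an invariant 2-set to a decomposition

  -- Applied to `∁ X` this gives the complementary part, so one argument for general `X` serves both
  -- simplices and both inscriptions.
  part : Subset n → Part (n + n) (n + n)
  part X = ⟨ X ++ ∁ X , ∁ X ++ X ⟩

  -- Pointwise form of φ(X) = X, equivalent to it because `φ` is a bijection; it passes to `∁ X` by
  -- mere negation.
  Invariant : Subset n → Set
  Invariant X = ∀ i → i ∈ X ⇔ φ ⟨$⟩ʳ i ∈ X

  ∁-invariant : ∀ {X} → Invariant X → Invariant (∁ X)
  ∁-invariant inv i = ⇔-trans ∈∁⇔∉ (⇔-trans (¬-cong-⇔ (inv i)) (⇔-sym ∈∁⇔∉))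

  module _ (X : Subset n) (inv : Invariant X) (∣X∣≡2 : ∣ X ∣ ≡ 2) (∣∁X∣≡2 : ∣ ∁ X ∣ ≡ 2) where

    private
      ≢-sym⇔ : {i j : Fin n} → i ≢ j ⇔ j ≢ i
      ≢-sym⇔ = mk⇔ (λ i≢j → i≢j ∘ sym) (λ j≢i → j≢i ∘ sym)

      point-a⁻ : ∀ {j} → a n j ∈ points (part X) → j ∈ X
      point-a⁻ = from (∈-++ˡ X (∁ X))

      point-b⁻ : ∀ {j} → b n j ∈ points (part X) → j ∈ ∁ X
      point-b⁻ = from (∈-++ʳ X (∁ X))

      block-a⁻ : ∀ {i} → a n i ∈ blocks (part X) → i ∈ ∁ X
      block-a⁻ = from (∈-++ˡ (∁ X) X)

      block-b⁻ : ∀ {i} → b n i ∈ blocks (part X) → i ∈ X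
      block-b⁻ = from (∈-++ʳ (∁ X) X)

      ∁-absurd : {A : Set} {i j : Fin n} → i ∈ X → j ∈ ∁ X → i ≡ j → A
      ∁-absurd i∈X j∈∁X refl = contradiction i∈X (x∈∁p⇒x∉p j∈∁X)

      ∉⇒≡ : {B : Set} {i j : Fin n} → B ⇔ j ≢ i → ¬ B → j ≡ i
      ∉⇒≡ {i = i} {j} B⇔ ¬B = decidable-stable (j ≟ i) (¬B ∘ from B⇔)

      -- Here `j ≢ φ ⟨$⟩ʳ i` means that `i` differs from the preimage of `j`, which lies in `X` by
      -- invariance.
      φ⁻¹-other : ∀ {j} → j ∈ X → ∃! _≡_ λ i → i ∈ X × j ≢ φ ⟨$⟩ʳ i
      φ⁻¹-other {j} j∈X = ∃!-cong
        (λ i → ⇔-refl ×-⇔ mk⇔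
          (λ i≢ j≡φi → i≢ (φ-injective (trans (sym j≡φi) (sym (inverseʳ φ)))))
          (λ j≢φi i≡ → j≢φi (trans (sym (inverseʳ φ)) (cong (φ ⟨$⟩ʳ_) (sym i≡)))))
        (∃!-other X ∣X∣≡2 (from (inv (φ ⟨$⟩ˡ j)) (subst (_∈ X) (sym (inverseʳ φ)) j∈X)))

    -- Indices from `X` and from `∁ X` never coincide, so each `aⱼ` of the part lies on all of its
    -- `Aᵢ`, and each `bⱼ` on all of its `Bᵢ`. The single miss occurs between unlike kinds, where
    -- both indices range over the same 2-set up to `φ`.
    part-isSimplex : IsSimplex (Möbius n φ) (part X)
    part-isSimplex = record
      { point-misses-one = halves _
          (λ j j∈ → ∃!-↑ʳ
            (∃!-cong (λ i → ∈-++ʳ (∁ X) X ×-⇔ ¬-cong-⇔ (⇔-sym a∈B)) (φ⁻¹-other (point-a⁻ j∈)))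
            (λ i (i∈ , j∉) → ∁-absurd (point-a⁻ j∈) (block-a⁻ i∈) (∉⇒≡ a∈A j∉)))
          (λ j j∈ → ∃!-↑ˡ
            (∃!-cong (λ i → ∈-++ˡ (∁ X) X ×-⇔ ⇔-trans ≢-sym⇔ (¬-cong-⇔ (⇔-sym b∈A)))
              (∃!-other (∁ X) ∣∁X∣≡2 (point-b⁻ j∈)))
            (λ i (i∈ , j∉) → ∁-absurd (block-b⁻ i∈) (point-b⁻ j∈) (sym (∉⇒≡ b∈B j∉))))
      ; block-misses-one = halves _
          (λ i i∈ → ∃!-↑ʳ
            (∃!-cong (λ j → ∈-++ʳ X (∁ X) ×-⇔ ¬-cong-⇔ (⇔-sym b∈A))
              (∃!-other (∁ X) ∣∁X∣≡2 (block-a⁻ i∈)))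
            (λ j (j∈ , j∉) → ∁-absurd (point-a⁻ j∈) (block-a⁻ i∈) (∉⇒≡ a∈A j∉)))
          (λ i i∈ → ∃!-↑ˡ
            (∃!-cong (λ j → ∈-++ˡ X (∁ X) ×-⇔ ¬-cong-⇔ (⇔-sym a∈B))
              (∃!-other X ∣X∣≡2 (to (inv i) (block-b⁻ i∈))))
            (λ j (j∈ , j∉) → ∁-absurd (block-b⁻ i∈) (point-b⁻ j∈) (sym (∉⇒≡ b∈B j∉))))
      }

    -- Now the single incidence occurs between like kinds, within one 2-set. Unlike kinds never
    -- meet: for `Aᵢ` and `bⱼ` the indices come from complementary sets, for `Bᵢ` and `aⱼ`
    -- invariance is used as well. `T` is given up to an equation because `∁ (∁ X)` equals `X` only
    -- propositionally.
    part-inscribed : (T : Part (n + n) (n + n)) → T ≡ ⟨ ∁ X ++ X , X ++ ∁ X ⟩ → Inscribed (Möbius n φ) (part X) T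
    part-inscribed _ refl = record
      { point-on-one = halves _
          (λ j j∈ → ∃!-↑ˡ
            (∃!-cong (λ i → ∈-++ˡ X (∁ X) ×-⇔ ⇔-trans ≢-sym⇔ (⇔-sym a∈A))
              (∃!-other X ∣X∣≡2 (point-a⁻ j∈)))
            (λ i (i∈ , j∈B) → ∁-absurd (point-a⁻ j∈)
              (to (∁-invariant inv i) (point-b⁻ i∈)) (to a∈B j∈B)))
          (λ j j∈ → ∃!-↑ʳ
            (∃!-cong (λ i → ∈-++ʳ X (∁ X) ×-⇔ ⇔-trans ≢-sym⇔ (⇔-sym b∈B))
              (∃!-other (∁ X) ∣∁X∣≡2 (point-b⁻ j∈)))
            (λ i (i∈ , j∈A) → ∁-absurd (point-a⁻ i∈) (point-b⁻ j∈) (sym (to b∈A j∈A))))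
      ; block-hits-one = halves _
          (λ i i∈ → ∃!-↑ˡ
            (∃!-cong (λ j → ∈-++ˡ (∁ X) X ×-⇔ ⇔-sym a∈A)
              (∃!-other (∁ X) ∣∁X∣≡2 (block-a⁻ i∈)))
            (λ j (j∈ , j∈A) → ∁-absurd (block-b⁻ j∈) (block-a⁻ i∈) (to b∈A j∈A)))
          (λ i i∈ → ∃!-↑ʳ
            (∃!-cong (λ j → ∈-++ʳ (∁ X) X ×-⇔ ⇔-sym b∈B)
              (∃!-other X ∣X∣≡2 (block-b⁻ i∈)))
            (λ j (j∈ , j∈B) → ∁-absurd (to (inv i) (block-b⁻ i∈)) (block-a⁻ j∈) (sym (to a∈B j∈B))))
      }

  invariant : ∀ {X} → ImageEqual φ X → Invariant X
  invariant {X} φX≡X i = mk⇔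
    (λ i∈X → to (φX≡X _) (i , i∈X , refl))
    (λ φi∈X → case from (φX≡X _) φi∈X of λ where
      (j , j∈X , φj≡φi) → subst (_∈ X) (φ-injective φj≡φi) j∈X)

  imageEqual : ∀ {X} → Invariant X → ImageEqual φ X
  imageEqual {X} inv y = mk⇔
    (λ { (x , x∈X , refl) → to (inv x) x∈X })
    (λ y∈X → φ ⟨$⟩ˡ y , from (inv _) (subst (_∈ X) (sym (inverseʳ φ)) y∈X) , inverseʳ φ)

  -- Block hits as equations between cardinalities

  -- The solutions of `P` form a one-element set of points, with trace `S` on the `aⱼ` and trace `T`
  -- on the `bⱼ`.
  ∃!⇒∣∣+∣∣≡1 : {P : Fin (n + n) → Set} (S T : Subset n) →
    (∀ j → P (a n j) ⇔ j ∈ S) → (∀ j → P (b n j) ⇔ j ∈ T) → ∃! _≡_ P → ∣ S ∣ + ∣ T ∣ ≡ 1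
  ∃!⇒∣∣+∣∣≡1 {P} S T P⇔S P⇔T ∃!P = trans (sym (∣++∣ S T)) (∃!⇒∣p∣≡1 (S ++ T) (∃!-cong P⇔S++T ∃!P))
    where
    P⇔S++T : ∀ k → P k ⇔ k ∈ S ++ T
    P⇔S++T = halves _ (λ j → ⇔-trans (P⇔S j) (∈-++ˡ S T)) (λ j → ⇔-trans (P⇔T j) (∈-++ʳ S T))

  -- A block meets its own kind of points in `p - x` and the other kind in `q ∩ ⁅ y ⁆`. Adding
  -- `⟦ lookup p x ⟧` to both sides restores `∣ p ∣` without any subtraction.
  ∣p-x∣+∣q∩⁅y⁆∣≡1⇒ : (p q : Subset n) (x y : Fin n) → ∣ p - x ∣ + ∣ q ∩ ⁅ y ⁆ ∣ ≡ 1 →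
    ∣ p ∣ + ⟦ lookup q y ⟧ ≡ 1 + ⟦ lookup p x ⟧
  ∣p-x∣+∣q∩⁅y⁆∣≡1⇒ p q x y eq = begin
    ∣ p ∣ + ⟦ lookup q y ⟧                      ≡⟨ cong (_+ ⟦ lookup q y ⟧) (∣p-x∣ p x) ⟨
    ∣ p - x ∣ + ⟦ lookup p x ⟧ + ⟦ lookup q y ⟧ ≡⟨ +-assoc ∣ p - x ∣ _ _ ⟩
    ∣ p - x ∣ + (⟦ lookup p x ⟧ + ⟦ lookup q y ⟧) ≡⟨ cong (∣ p - x ∣ +_) (+-comm ⟦ lookup p x ⟧ _) ⟩
    ∣ p - x ∣ + (⟦ lookup q y ⟧ + ⟦ lookup p x ⟧) ≡⟨ +-assoc ∣ p - x ∣ _ _ ⟨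
    ∣ p - x ∣ + ⟦ lookup q y ⟧ + ⟦ lookup p x ⟧ ≡⟨ cong (λ k → ∣ p - x ∣ + k + ⟦ lookup p x ⟧) (∣p∩⁅x⁆∣ q y) ⟨
    ∣ p - x ∣ + ∣ q ∩ ⁅ y ⁆ ∣ + ⟦ lookup p x ⟧   ≡⟨ cong (_+ ⟦ lookup p x ⟧) eq ⟩
    1 + ⟦ lookup p x ⟧                          ∎
    where open ≡-Reasoning

  module _ (X Y : Subset n) (i : Fin n) where

    A-hits-one : ∃! _≡_ (λ p → p ∈ X ++ Y × p ∈ block (a n i)) →
      ∣ X ∣ + ⟦ lookup Y i ⟧ ≡ 1 + ⟦ lookup X i ⟧
    A-hits-one = ∣p-x∣+∣q∩⁅y⁆∣≡1⇒ X Y i i ∘ ∃!⇒∣∣+∣∣≡1 (X - i) (Y ∩ ⁅ i ⁆)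
      (λ j → ⇔-trans (⇔-sym (∈-++ˡ X Y) ×-⇔ a∈A) (⇔-sym (∈p-x⇔ X)))
      (λ j → ⇔-trans (⇔-sym (∈-++ʳ X Y) ×-⇔ b∈A) (⇔-sym (∈p∩⁅x⁆⇔ Y)))

    B-hits-one : ∃! _≡_ (λ p → p ∈ X ++ Y × p ∈ block (b n i)) →
      ∣ Y ∣ + ⟦ lookup X (φ ⟨$⟩ʳ i) ⟧ ≡ 1 + ⟦ lookup Y i ⟧
    -- The traces are listed with the `aⱼ` first, but the own kind of `Bᵢ` is the `bⱼ`; hence the
    -- commutation.
    B-hits-one = ∣p-x∣+∣q∩⁅y⁆∣≡1⇒ Y X i (φ ⟨$⟩ʳ i) ∘ trans (+-comm ∣ Y - i ∣ _) ∘
      ∃!⇒∣∣+∣∣≡1 (X ∩ ⁅ φ ⟨$⟩ʳ i ⁆) (Y - i)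
        (λ j → ⇔-trans (⇔-sym (∈-++ˡ X Y) ×-⇔ a∈B) (⇔-sym (∈p∩⁅x⁆⇔ X)))
        (λ j → ⇔-trans (⇔-sym (∈-++ʳ X Y) ×-⇔ b∈B) (⇔-sym (∈p-x⇔ Y)))

  bipartition : {P Q : Subset (n + n)} → Q ≡ ∁ P → ∣ P ∣ ≡ n → ∣ Q ∣ ≡ n → Bipartition n P Q
  bipartition {P} refl ∣P∣≡n ∣Q∣≡n = record
    { disjoint = ∩-inverseʳ P ; covering = p∪∁p≡⊤ P ; size₁ = ∣P∣≡n ; size₂ = ∣Q∣≡n }

  special : n ≡ 4 → (X : Subset n) → ∣ X ∣ ≡ 2 → ImageEqual φ X → SpecialDecomposition n φ
  special refl X ∣X∣≡2 φX≡X = record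
    { S₁ = part X
    ; S₂ = part (∁ X)
    ; points-partition = bipartition (sym (map-++ not X (∁ X)))
        (∣++∣≡4 X (∁ X) ∣X∣≡2 ∣∁X∣≡2) (∣++∣≡4 (∁ X) (∁ (∁ X)) ∣∁X∣≡2 ∣∁∁X∣≡2)
    ; blocks-partition = bipartition (sym (map-++ not (∁ X) X))
        (∣++∣≡4 (∁ X) X ∣∁X∣≡2 ∣X∣≡2) (∣++∣≡4 (∁ (∁ X)) (∁ X) ∣∁∁X∣≡2 ∣∁X∣≡2)
    ; simplex₁ = part-isSimplex X inv ∣X∣≡2 ∣∁X∣≡2
    ; simplex₂ = part-isSimplex (∁ X) (∁-invariant inv) ∣∁X∣≡2 ∣∁∁X∣≡2
    ; inscribed₁₂ = part-inscribed X inv ∣X∣≡2 ∣∁X∣≡2 _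
        (cong (λ Z → ⟨ ∁ X ++ Z , Z ++ ∁ X ⟩) (∁-involutive X))
    ; inscribed₂₁ = part-inscribed (∁ X) (∁-invariant inv) ∣∁X∣≡2 ∣∁∁X∣≡2 _
        (cong (λ Z → ⟨ Z ++ ∁ X , ∁ X ++ Z ⟩) (sym (∁-involutive X)))
    } , record
    { S₁≢A = ≢A X ∣X∣≡2 ; S₁≢B = ≢B X ∣X∣≡2 ; S₂≢A = ≢A (∁ X) ∣∁X∣≡2 ; S₂≢B = ≢B (∁ X) ∣∁X∣≡2 }
    where
    inv : Invariant X
    inv = invariant φX≡X

    ∣∁∣≡2 : (Z : Subset 4) → ∣ Z ∣ ≡ 2 → ∣ ∁ Z ∣ ≡ 2
    ∣∁∣≡2 Z ∣Z∣≡2 = +-cancelˡ-≡ 2 _ _ (trans (cong (_+ ∣ ∁ Z ∣) (sym ∣Z∣≡2)) (∣p∣+∣∁p∣≡n Z))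

    ∣∁X∣≡2 : ∣ ∁ X ∣ ≡ 2
    ∣∁X∣≡2 = ∣∁∣≡2 X ∣X∣≡2

    ∣∁∁X∣≡2 : ∣ ∁ (∁ X) ∣ ≡ 2
    ∣∁∁X∣≡2 = ∣∁∣≡2 (∁ X) ∣∁X∣≡2

    ∣++∣≡4 : (Z W : Subset 4) → ∣ Z ∣ ≡ 2 → ∣ W ∣ ≡ 2 → ∣ Z ++ W ∣ ≡ 4
    ∣++∣≡4 Z W ∣Z∣≡2 ∣W∣≡2 = trans (∣++∣ Z W) (cong₂ _+_ ∣Z∣≡2 ∣W∣≡2)

    -- Comparing first halves of the point sets would make `Z` full here, and empty in `≢B`; a set
    -- of size 2 is neither.
    ≢A : (Z : Subset 4) → ∣ Z ∣ ≡ 2 → part Z ≢ simplexA 4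
    ≢A Z ∣Z∣≡2 eq with refl ← ++-injectiveˡ Z ⊤ (cong points eq) with () ← ∣Z∣≡2

    ≢B : (Z : Subset 4) → ∣ Z ∣ ≡ 2 → part Z ≢ simplexB 4
    ≢B Z ∣Z∣≡2 eq with refl ← ++-injectiveˡ Z ⊥ (cong points eq) with () ← ∣Z∣≡2

  -- From a decomposition to an invariant 2-set

  -- With the first halves empty, `n` elements must fill the second halves.
  ⟨⟩≡simplexB : {X Y U V : Subset n} → ∣ X ++ Y ∣ ≡ n → ∣ U ++ V ∣ ≡ n → X ≡ ⊥ → U ≡ ⊥ →
    ⟨ X ++ Y , U ++ V ⟩ ≡ simplexB n
  ⟨⟩≡simplexB {Y = Y} {V = V} ∣XY∣≡n ∣UV∣≡n refl refl = cong₂ ⟨_,_⟩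
    (cong (⊥ {n} ++_) (∣⊥++q∣≡n⇒q≡⊤ Y ∣XY∣≡n)) (cong (⊥ {n} ++_) (∣⊥++q∣≡n⇒q≡⊤ V ∣UV∣≡n))

  module _ (X Y U V : Subset n) (n≥4 : n ≥ 4)
    (∣XY∣≡n : ∣ X ++ Y ∣ ≡ n) (∣∁X∁Y∣≡n : ∣ ∁ X ++ ∁ Y ∣ ≡ n)
    (∣UV∣≡n : ∣ U ++ V ∣ ≡ n) (∣∁U∁V∣≡n : ∣ ∁ U ++ ∁ V ∣ ≡ n)
    (inscribed₁₂ : Inscribed (Möbius n φ) ⟨ X ++ Y , U ++ V ⟩ ⟨ ∁ X ++ ∁ Y , ∁ U ++ ∁ V ⟩)
    (inscribed₂₁ : Inscribed (Möbius n φ) ⟨ ∁ X ++ ∁ Y , ∁ U ++ ∁ V ⟩ ⟨ X ++ Y , U ++ V ⟩)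
    (S₁≢B : ⟨ X ++ Y , U ++ V ⟩ ≢ simplexB n)
    (S₂≢B : ⟨ ∁ X ++ ∁ Y , ∁ U ++ ∁ V ⟩ ≢ simplexB n) where
    open Inscribed

    private
      ∣X∣+∣Y∣≡n : ∣ X ∣ + ∣ Y ∣ ≡ n
      ∣X∣+∣Y∣≡n = trans (sym (∣++∣ X Y)) ∣XY∣≡n

      -- A block counts the points of the opposite part: blocks of S₂ give equations in `X` and `Y`,
      -- blocks of S₁ give them in the complements.
      A-hits : ∀ {i} → i ∈ ∁ U → ∣ X ∣ + ⟦ lookup Y i ⟧ ≡ 1 + ⟦ lookup X i ⟧
      A-hits i∈ = A-hits-one X Y _ (block-hits-one inscribed₂₁ _ (to (∈-++ˡ (∁ U) (∁ V)) i∈))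

      A-hits-∁ : ∀ {i} → i ∈ U → ∣ ∁ X ∣ + ⟦ lookup (∁ Y) i ⟧ ≡ 1 + ⟦ lookup (∁ X) i ⟧
      A-hits-∁ i∈ = A-hits-one (∁ X) (∁ Y) _ (block-hits-one inscribed₁₂ _ (to (∈-++ˡ U V) i∈))

      B-hits : ∀ {i} → i ∈ ∁ V → ∣ Y ∣ + ⟦ lookup X (φ ⟨$⟩ʳ i) ⟧ ≡ 1 + ⟦ lookup Y i ⟧
      B-hits i∈ = B-hits-one X Y _ (block-hits-one inscribed₂₁ _ (to (∈-++ʳ (∁ U) (∁ V)) i∈))

      B-hits-∁ : ∀ {i} → i ∈ V → ∣ ∁ Y ∣ + ⟦ lookup (∁ X) (φ ⟨$⟩ʳ i) ⟧ ≡ 1 + ⟦ lookup (∁ Y) i ⟧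
      B-hits-∁ i∈ = B-hits-one (∁ X) (∁ Y) _ (block-hits-one inscribed₁₂ _ (to (∈-++ʳ U V) i∈))

    invariant-2-set : n ≡ 4 × ∃ λ (Z : Subset n) → ∣ Z ∣ ≡ 2 × ImageEqual φ Z
    invariant-2-set with nonempty? U | nonempty? (∁ U)
    ... | no U-empty | _ = ⊥-elim (S₁≢B (⟨⟩≡simplexB ∣XY∣≡n ∣UV∣≡n
          (all-hit⇒≡⊥ X Y n≥4 ∣X∣+∣Y∣≡n (λ i → A-hits (x∉p⇒x∈∁p (λ i∈U → U-empty (i , i∈U)))))
          (Empty-unique U-empty)))
    ... | yes _ | no ∁U-empty = ⊥-elim (S₂≢B (⟨⟩≡simplexB ∣∁X∁Y∣≡n ∣∁U∁V∣≡n
          (all-hit⇒≡⊥ (∁ X) (∁ Y) n≥4 (trans (sym (∣++∣ (∁ X) (∁ Y))) ∣∁X∁Y∣≡n)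
            (λ i → A-hits-∁ (x∉∁p⇒x∈p (λ i∈∁U → ∁U-empty (i , i∈∁U)))))
          (Empty-unique ∁U-empty)))
    ... | yes (i , i∈U) | yes (j , j∈∁U) = n≡4 , X , ∣X∣≡2 , imageEqual invariant-X
      where
      ∣X∣≤2 : ∣ X ∣ ≤ 2
      ∣X∣≤2 = m+⟦⟧≡1+⟦⟧⇒m≤2 (lookup Y j) (lookup X j) (A-hits j∈∁U)

      ∣∁X∣≤2 : ∣ ∁ X ∣ ≤ 2
      ∣∁X∣≤2 = m+⟦⟧≡1+⟦⟧⇒m≤2 (lookup (∁ Y) i) (lookup (∁ X) i) (A-hits-∁ i∈U)

      4≤∣X∣+∣∁X∣ : 4 ≤ ∣ X ∣ + ∣ ∁ X ∣
      4≤∣X∣+∣∁X∣ = subst (4 ≤_) (sym (∣p∣+∣∁p∣≡n X)) n≥4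

      ∣X∣≡2 : ∣ X ∣ ≡ 2
      ∣X∣≡2 = 4≤m+n⇒m≡2 4≤∣X∣+∣∁X∣ ∣X∣≤2 ∣∁X∣≤2

      ∣∁X∣≡2 : ∣ ∁ X ∣ ≡ 2
      ∣∁X∣≡2 = 4≤m+n⇒m≡2 (subst (4 ≤_) (+-comm ∣ X ∣ _) 4≤∣X∣+∣∁X∣) ∣∁X∣≤2 ∣X∣≤2

      n≡4 : n ≡ 4
      n≡4 = trans (sym (∣p∣+∣∁p∣≡n X)) (cong₂ _+_ ∣X∣≡2 ∣∁X∣≡2)

      ∣Y∣≡2 : ∣ Y ∣ ≡ 2
      ∣Y∣≡2 = +-cancelˡ-≡ 2 _ _ (trans (cong (_+ ∣ Y ∣) (sym ∣X∣≡2)) (trans ∣X∣+∣Y∣≡n n≡4))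

      ∣∁Y∣≡2 : ∣ ∁ Y ∣ ≡ 2
      ∣∁Y∣≡2 = +-cancelˡ-≡ 2 _ _ (trans (cong (_+ ∣ ∁ Y ∣) (sym ∣Y∣≡2)) (trans (∣p∣+∣∁p∣≡n Y) n≡4))

      2-hit⇒≡not : ∀ {c} s t → c ≡ 2 → c + ⟦ s ⟧ ≡ 1 + ⟦ t ⟧ → s ≡ not t
      2-hit⇒≡not s t refl eq = proj₁ (2+⟦⟧≡1+⟦⟧ s t eq)

      -- Each `Aᵢ` belongs to one of the two parts, and since `X` and `∁ X` both have size 2, either
      -- version of its equation leads to the same relation at `i`.
      Y≡∁X : ∀ i → lookup Y i ≡ not (lookup X i)
      Y≡∁X i with i ∈? U
      ... | yes i∈U = lookup-∁⁻ Y X (2-hit⇒≡not _ _ ∣∁X∣≡2 (A-hits-∁ i∈U))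
      ... | no  i∉U = 2-hit⇒≡not _ _ ∣X∣≡2 (A-hits (x∉p⇒x∈∁p i∉U))

      X∘φ≡∁Y : ∀ i → lookup X (φ ⟨$⟩ʳ i) ≡ not (lookup Y i)
      X∘φ≡∁Y i with i ∈? V
      ... | yes i∈V = lookup-∁⁻ X Y (2-hit⇒≡not _ _ ∣∁Y∣≡2 (B-hits-∁ i∈V))
      ... | no  i∉V = 2-hit⇒≡not _ _ ∣Y∣≡2 (B-hits (x∉p⇒x∈∁p i∉V))

      X∘φ≡X : ∀ i → lookup X (φ ⟨$⟩ʳ i) ≡ lookup X i
      X∘φ≡X i = trans (X∘φ≡∁Y i) (trans (cong not (Y≡∁X i)) (not-involutive _))

      invariant-X : Invariant X
      invariant-X i = mk⇔
        (λ i∈X → lookup⇒[]= _ X (trans (X∘φ≡X i) ([]=⇒lookup i∈X)))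
        (λ φi∈X → lookup⇒[]= i X (trans (sym (X∘φ≡X i)) ([]=⇒lookup φi∈X)))

  special⇒invariant : n ≥ 4 → SpecialDecomposition n φ →
    n ≡ 4 × ∃ λ (Z : Subset n) → ∣ Z ∣ ≡ 2 × ImageEqual φ Z
  special⇒invariant n≥4 (record
    { S₁ = ⟨ P , K ⟩ ; S₂ = ⟨ P′ , K′ ⟩
    ; points-partition = points ; blocks-partition = blocks
    ; inscribed₁₂ = inscribed₁₂ ; inscribed₂₁ = inscribed₂₁ } , record { S₁≢B = S₁≢B ; S₂≢B = S₂≢B })
    -- Cutting the sets of S₁ into halves produces `X`, `Y`, `U`, `V`; the partition conditions then
    -- force the sets of S₂ to be the halfwise complements.
    with Vec.splitAt n P | Vec.splitAt n K
  ... | X , Y , refl | U , V , refl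
    with refl ← complement-++ X Y P′ (Bipartition.disjoint points) (Bipartition.covering points)
       | refl ← complement-++ U V K′ (Bipartition.disjoint blocks) (Bipartition.covering blocks)
    = invariant-2-set X Y U V n≥4
        (Bipartition.size₁ points) (Bipartition.size₂ points)
        (Bipartition.size₁ blocks) (Bipartition.size₂ blocks)
        inscribed₁₂ inscribed₂₁ S₁≢B S₂≢B

proposition2p3 : ∀ (n : ℕ) → n ≥ 4 → (φ : Permutation′ n) →
    SpecialDecomposition n φ ⇔ (n ≡ 4 × ∃ λ (X : Subset n) → ∣ X ∣ ≡ 2 × ImageEqual φ X)
proposition2p3 n n≥4 φ = mk⇔
  (special⇒invariant n φ n≥4)
  (λ (n≡4 , X , ∣X∣≡2 , φX≡X) → special n φ n≡4 X ∣X∣≡2 φX≡X)
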